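{- Let $G$ be a graph of order $n$ with minimum degree $\delta$. If $\delta>0$ and $n<\delta^2/(\ln\delta+1)$, then $$ \gamma_r(G)\le\frac{\ln(\delta+1)+1}{\delta+1}\,n \qquad\text{and}\qquad \gamma_{\mathrm{tr}}(G)\le\frac{\ln\delta+1}{\delta}\,n . $$
   Context: All graphs are finite and undirected, without loops or multiple edges. A set $X\subseteq V(G)$ is a dominating set of $G$ if every vertex not in $X$ is adjacent to a vertex in $X$. A dominating set $X$ is a restrained dominating set if every vertex in $V(G)-X$ is adjacent to a vertex in $V(G)-X$; $\gamma_r(G)$ is the minimum cardinality of a restrained dominating set. A restrained dominating set $X$ is a total restrained dominating set if, in addition, every vertex of $X$ is adjacent to a vertex of $X$; $\gamma_{\mathrm{tr}}(G)$ is the minimum cardinality of a total restrained dominating set. -}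

module Defs where

open import Data.Fin using (Fin)
open import Data.Fin.Subset using (Subset; _∈_; _∉_; ∣_∣)
open import Data.Integer using (+_; +[1+_])
import Data.Integer as ℤ
import Data.Integer.Properties as ℤₚ
import Data.Integer.Tactic.RingSolver as ℤ-Ring
open import Data.Nat using (ℕ; zero; suc; pred; NonZero; z≤n; s≤s)
import Data.Nat as ℕ
import Data.Nat.Properties as ℕₚ
import Data.Nat.Tactic.RingSolver as ℕ-Ring
open import Data.Product using (∃-syntax; _×_; _,_; proj₁; proj₂)
open import Data.Rational
  using (ℚ; mkℚ; 0ℚ; 1ℚ; ½; toℚᵘ; _+_; _*_; _-_; -_; _≤_; _<_)
import Data.Rational as ℚ
import Data.Rational.Properties as ℚₚ
import Data.Rational.Unnormalised as ℚᵘ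
import Data.Rational.Unnormalised.Properties as ℚᵘₚ
open import Data.Rational.Solver using (module +-*-Solver)
open import Data.Sum using (inj₁; inj₂)
open import Data.Vec using (tabulate)
open import Level using (0ℓ)
open import Relation.Binary using (Decidable; Irreflexive; Rel; Symmetric)
open import Relation.Binary.PropositionalEquality
  using (_≡_; refl; sym; trans; cong; cong₂; subst; subst₂)
open import Relation.Nullary using (does; yes; no; contradiction)
open import Relation.Unary using (Pred)

record Graph (n : ℕ) : Set₁ where
  infix 4 _~_ _~?_
  field
    _~_   : Rel (Fin n) 0ℓ
    _~?_  : Decidable _~_
    ~-sym : Symmetric _~_
    ~-irr : Irreflexive _≡_ _~_

module _ {n : ℕ} (G : Graph n) where
  open Graph G

  neighbours : Fin n → Subset n
  neighbours v = tabulate λ u → does (v ~? u)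

  degree : Fin n → ℕ
  degree v = ∣ neighbours v ∣

  IsMinimumDegree : ℕ → Set
  IsMinimumDegree δ = (∃[ v ] degree v ≡ δ) × (∀ v → δ ℕ.≤ degree v)

  Dominating : Pred (Subset n) 0ℓ
  Dominating X = ∀ v → v ∉ X → ∃[ u ] (u ∈ X × v ~ u)

  RestrainedDominating : Pred (Subset n) 0ℓ
  RestrainedDominating X =
    Dominating X × (∀ v → v ∉ X → ∃[ u ] (u ∉ X × v ~ u))

  TotalRestrainedDominating : Pred (Subset n) 0ℓ
  TotalRestrainedDominating X =
    RestrainedDominating X × (∀ v → v ∈ X → ∃[ u ] (u ∈ X × v ~ u))

IsMinimumCardinality : ∀ {n} → Pred (Subset n) 0ℓ → ℕ → Set
IsMinimumCardinality P k =
  (∃[ X ] (P X × ∣ X ∣ ≡ k)) × (∀ X → P X → k ℕ.≤ ∣ X ∣)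

Isγᵣ : ∀ {n} → Graph n → ℕ → Set
Isγᵣ G = IsMinimumCardinality (RestrainedDominating G)

Isγₜᵣ : ∀ {n} → Graph n → ℕ → Set
Isγₜᵣ G = IsMinimumCardinality (TotalRestrainedDominating G)

∣x∣≤ : ∀ {p q} → p ≤ q → - p ≤ q → ℚ.∣ p ∣ ≤ q
∣x∣≤ {p} p≤q -p≤q with ℚₚ.∣p∣≡p∨∣p∣≡-p p
... | inj₁ e = subst (_≤ _) (sym e) p≤q
... | inj₂ e = subst (_≤ _) (sym e) -p≤q

≤-shift : ∀ {p q r} → p ≤ q + r → p - q ≤ r
≤-shift {p} {q} {r} p≤ = subst (p - q ≤_) eq (ℚₚ.+-monoˡ-≤ (- q) p≤)
  where
  eq : (q + r) - q ≡ r
  eq = solve 2 (λ q r → (q :+ r) :+ (:- q) := r) refl q r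
    where open +-*-Solver

-[p-q] : ∀ p q → - (p - q) ≡ q - p
-[p-q] = solve 2 (λ p q → :- (p :+ (:- q)) := q :+ (:- p)) refl
  where open +-*-Solver

*-mono-≤-nonNeg : ∀ {p q r s} → 0ℚ ≤ p → 0ℚ ≤ s →
                  p ≤ q → r ≤ s → p * r ≤ q * s
*-mono-≤-nonNeg {p} {q} {r} {s} 0≤p 0≤s p≤q r≤s = ℚₚ.≤-trans
  (ℚₚ.*-monoˡ-≤-nonNeg p {{ℚ.nonNegative 0≤p}} r≤s)
  (ℚₚ.*-monoʳ-≤-nonNeg s {{ℚ.nonNegative 0≤s}} p≤q)

0<*0< : ∀ {p q} → 0ℚ < p → 0ℚ < q → 0ℚ < p * q
0<*0< {p} {q} 0<p 0<q = ℚₚ.positive⁻¹ (p * q)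
  {{ℚₚ.pos*pos⇒pos p {{ℚ.positive 0<p}} q {{ℚ.positive 0<q}}}}

0<½ : 0ℚ < ½
0<½ = ℚₚ.positive⁻¹ ½

halves : ∀ ε → ½ * ε + ½ * ε ≡ ε
halves ε = trans (sym (ℚₚ.*-distribʳ-+ ε ½ ½)) (ℚₚ.*-identityˡ ε)

inv : ℚ → ℚ
inv q with q ℚ.≟ 0ℚ
... | yes _   = 0ℚ
... | no  q≢0 = ℚ.1/_ q {{ℚ.≢-nonZero q≢0}}

inv-inverseˡ : ∀ {q} → 0ℚ < q → inv q * q ≡ 1ℚ
inv-inverseˡ {q} 0<q with q ℚ.≟ 0ℚ
... | yes q≡0 = contradiction (sym q≡0) (ℚₚ.<⇒≢ 0<q)
... | no  q≢0 = ℚₚ.*-inverseˡ q {{ℚ.≢-nonZero q≢0}}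

inv-positive : ∀ {q} → 0ℚ < q → 0ℚ < inv q
inv-positive {q} 0<q with q ℚ.≟ 0ℚ
... | yes q≡0 = contradiction (sym q≡0) (ℚₚ.<⇒≢ 0<q)
... | no  q≢0 = ℚₚ.positive⁻¹ (ℚ.1/_ q {{ℚ.≢-nonZero q≢0}})
                  {{ℚₚ.1/pos⇒pos q {{ℚ.positive 0<q}}}}

inv-antimono : ∀ {p q} → 0ℚ < p → p ≤ q → inv q ≤ inv p
inv-antimono {p} {q} 0<p p≤q = subst₂ _≤_ eq₁ eq₂
  (ℚₚ.*-monoˡ-≤-nonNeg (inv p * inv q) {{ℚ.nonNegative 0≤}} p≤q)
  where
  open +-*-Solver
  0<q = ℚₚ.<-≤-trans 0<p p≤q
  0≤ : 0ℚ ≤ inv p * inv q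
  0≤ = ℚₚ.<⇒≤ (0<*0< (inv-positive 0<p) (inv-positive 0<q))
  eq₁ : (inv p * inv q) * p ≡ inv q
  eq₁ = trans (solve 3 (λ a b c → (a :* b) :* c := (a :* c) :* b) refl
                 (inv p) (inv q) p)
        (trans (cong (_* inv q) (inv-inverseˡ 0<p)) (ℚₚ.*-identityˡ _))
  eq₂ : (inv p * inv q) * q ≡ inv p
  eq₂ = trans (ℚₚ.*-assoc (inv p) (inv q) q)
        (trans (cong (inv p *_) (inv-inverseˡ 0<q)) (ℚₚ.*-identityʳ _))

IsCauchy : (ℕ → ℚ) → Set
IsCauchy x = ∀ ε → 0ℚ < ε →
  ∃[ K ] (∀ i j → K ℕ.≤ i → K ℕ.≤ j → ℚ.∣ x i - x j ∣ ≤ ε)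

record ℝ : Set where
  constructor mkℝ
  field
    seq    : ℕ → ℚ
    cauchy : IsCauchy seq

open ℝ public

infix 4 _≤ℝ_ _<ℝ_

_≤ℝ_ : Rel ℝ 0ℓ
x ≤ℝ y = ∀ ε → 0ℚ < ε → ∃[ K ] (∀ i → K ℕ.≤ i → seq x i ≤ seq y i + ε)

record _<ℝ_ (x y : ℝ) : Set where
  constructor mk<
  field
    gap    : ℚ
    0<gap  : 0ℚ < gap
    from   : ℕ
    proof  : ∀ i → from ℕ.≤ i → seq x i + gap ≤ seq y i

fromℚ : ℚ → ℝ
fromℚ q = mkℝ (λ _ → q) λ ε 0<ε → 0 , λ _ _ _ _ →
  subst (λ p → ℚ.∣ p ∣ ≤ ε) (sym (ℚₚ.+-inverseʳ q)) (ℚₚ.<⇒≤ 0<ε)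

fromℕ : ℕ → ℝ
fromℕ n = fromℚ (+ n ℚ./ 1)

0ℝ : ℝ
0ℝ = fromℕ 0

1ℝ : ℝ
1ℝ = fromℕ 1

infixl 6 _+ℝ_
infixl 7 _*ℝ_ _/ℝ_[_]

+-cauchy : ∀ {x y} → IsCauchy x → IsCauchy y → IsCauchy (λ i → x i + y i)
+-cauchy {x} {y} cx cy ε 0<ε
  with cx (½ * ε) (0<*0< 0<½ 0<ε) | cy (½ * ε) (0<*0< 0<½ 0<ε)
... | K , hx | L , hy = K ℕ.⊔ L , λ i j i≥ j≥ →
  let open ℚₚ.≤-Reasoning in begin
  ℚ.∣ (x i + y i) - (x j + y j) ∣    ≡⟨ cong ℚ.∣_∣ (eq (x i) (y i) (x j) (y j)) ⟩
  ℚ.∣ (x i - x j) + (y i - y j) ∣    ≤⟨ ℚₚ.∣p+q∣≤∣p∣+∣q∣ (x i - x j) (y i - y j) ⟩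
  ℚ.∣ x i - x j ∣ + ℚ.∣ y i - y j ∣  ≤⟨ ℚₚ.+-mono-≤
    (hx i j (ℕₚ.m⊔n≤o⇒m≤o K L i≥) (ℕₚ.m⊔n≤o⇒m≤o K L j≥))
    (hy i j (ℕₚ.m⊔n≤o⇒n≤o K L i≥) (ℕₚ.m⊔n≤o⇒n≤o K L j≥)) ⟩
  ½ * ε + ½ * ε                      ≡⟨ halves ε ⟩
  ε                                  ∎
  where
  open +-*-Solver
  eq : ∀ a b c d → (a + b) - (c + d) ≡ (a - c) + (b - d)
  eq = solve 4 (λ a b c d → (a :+ b) :+ (:- (c :+ d))
                         := (a :+ (:- c)) :+ (b :+ (:- d))) refl

_+ℝ_ : ℝ → ℝ → ℝ
x +ℝ y = mkℝ (λ i → seq x i + seq y i) (+-cauchy {seq x} {seq y} (cauchy x) (cauchy y))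

cauchy⇒bounded : ∀ {x} → IsCauchy x →
  ∃[ B ] (0ℚ < B × ∃[ K ] (∀ i → K ℕ.≤ i → ℚ.∣ x i ∣ ≤ B))
cauchy⇒bounded {x} cx with cx 1ℚ (ℚₚ.positive⁻¹ 1ℚ)
... | K , h = ℚ.∣ x K ∣ + 1ℚ , 0<B , K , λ i i≥ →
  let open ℚₚ.≤-Reasoning in begin
  ℚ.∣ x i ∣                      ≡⟨ cong ℚ.∣_∣ (eq (x i) (x K)) ⟩
  ℚ.∣ x K + (x i - x K) ∣        ≤⟨ ℚₚ.∣p+q∣≤∣p∣+∣q∣ (x K) (x i - x K) ⟩
  ℚ.∣ x K ∣ + ℚ.∣ x i - x K ∣    ≤⟨ ℚₚ.+-monoʳ-≤ ℚ.∣ x K ∣ (h i K i≥ ℕₚ.≤-refl) ⟩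
  ℚ.∣ x K ∣ + 1ℚ                 ∎
  where
  open +-*-Solver
  eq : ∀ a b → a ≡ b + (a - b)
  eq = solve 2 (λ a b → a := b :+ (a :+ (:- b))) refl
  0<B : 0ℚ < ℚ.∣ x K ∣ + 1ℚ
  0<B = ℚₚ.+-mono-≤-< (ℚₚ.0≤∣p∣ (x K)) (ℚₚ.positive⁻¹ 1ℚ)

∣ab-cd∣≤ : ∀ a b c d {B C e f h} → 0ℚ ≤ C → 0ℚ ≤ e →
  ℚ.∣ a ∣ ≤ B → ℚ.∣ b - d ∣ ≤ e → ℚ.∣ a - c ∣ ≤ f → ℚ.∣ d ∣ ≤ C →
  e * B ≡ h → f * C ≡ h → ℚ.∣ a * b - c * d ∣ ≤ h + h
∣ab-cd∣≤ a b c d {B} {C} {e} {f} {h} 0≤C 0≤e a≤ b≤ c≤ d≤ eB fC =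
  let open ℚₚ.≤-Reasoning in begin
  ℚ.∣ a * b - c * d ∣                        ≡⟨ cong ℚ.∣_∣ (eq a b c d) ⟩
  ℚ.∣ a * (b - d) + (a - c) * d ∣
    ≤⟨ ℚₚ.∣p+q∣≤∣p∣+∣q∣ (a * (b - d)) ((a - c) * d) ⟩
  ℚ.∣ a * (b - d) ∣ + ℚ.∣ (a - c) * d ∣
    ≡⟨ cong₂ _+_ (ℚₚ.∣p*q∣≡∣p∣*∣q∣ a (b - d)) (ℚₚ.∣p*q∣≡∣p∣*∣q∣ (a - c) d) ⟩
  ℚ.∣ a ∣ * ℚ.∣ b - d ∣ + ℚ.∣ a - c ∣ * ℚ.∣ d ∣
    ≤⟨ ℚₚ.+-mono-≤
         (*-mono-≤-nonNeg (ℚₚ.0≤∣p∣ a) 0≤e a≤ b≤)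
         (*-mono-≤-nonNeg (ℚₚ.0≤∣p∣ (a - c)) 0≤C c≤ d≤) ⟩
  B * e + f * C                              ≡⟨ cong₂ _+_ (trans (ℚₚ.*-comm B e) eB) fC ⟩
  h + h                                      ∎
  where
  open +-*-Solver
  eq : ∀ a b c d → a * b - c * d ≡ a * (b - d) + (a - c) * d
  eq = solve 4 (λ a b c d → (a :* b) :+ (:- (c :* d))
                := (a :* (b :+ (:- d))) :+ ((a :+ (:- c)) :* d)) refl

*-inv-cancel : ∀ h {D} → 0ℚ < D → h * inv D * D ≡ h
*-inv-cancel h {D} 0<D = trans (ℚₚ.*-assoc h (inv D) D)
  (trans (cong (h *_) (inv-inverseˡ 0<D)) (ℚₚ.*-identityʳ h))

*-cauchy : ∀ {x y} → IsCauchy x → IsCauchy y → IsCauchy (λ i → x i * y i)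
*-cauchy {x} {y} cx cy ε 0<ε = subst Goal (halves ε) (bound (½ * ε) (0<*0< 0<½ 0<ε))
  where
  Goal : ℚ → Set
  Goal e = ∃[ K ] (∀ i j → K ℕ.≤ i → K ℕ.≤ j → ℚ.∣ x i * y i - x j * y j ∣ ≤ e)
  bound : ∀ h → 0ℚ < h → Goal (h + h)
  bound h 0<h =
    let (B , 0<B , K₁ , hB) = cauchy⇒bounded cx
        (C , 0<C , K₂ , hC) = cauchy⇒bounded cy
        0<f = 0<*0< 0<h (inv-positive 0<C)
        0<e = 0<*0< 0<h (inv-positive 0<B)
        (K₃ , hx) = cx (h * inv C) 0<f
        (K₄ , hy) = cy (h * inv B) 0<e
        L = K₁ ℕ.⊔ K₂
        M = K₃ ℕ.⊔ K₄
    in L ℕ.⊔ M , λ i j i≥ j≥ →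
      let i≥L = ℕₚ.m⊔n≤o⇒m≤o L M i≥
          i≥M = ℕₚ.m⊔n≤o⇒n≤o L M i≥
          j≥L = ℕₚ.m⊔n≤o⇒m≤o L M j≥
          j≥M = ℕₚ.m⊔n≤o⇒n≤o L M j≥
      in ∣ab-cd∣≤ (x i) (y i) (x j) (y j) (ℚₚ.<⇒≤ 0<C) (ℚₚ.<⇒≤ 0<e)
           (hB i (ℕₚ.m⊔n≤o⇒m≤o K₁ K₂ i≥L))
           (hy i j (ℕₚ.m⊔n≤o⇒n≤o K₃ K₄ i≥M) (ℕₚ.m⊔n≤o⇒n≤o K₃ K₄ j≥M))
           (hx i j (ℕₚ.m⊔n≤o⇒m≤o K₃ K₄ i≥M) (ℕₚ.m⊔n≤o⇒m≤o K₃ K₄ j≥M))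
           (hC j (ℕₚ.m⊔n≤o⇒n≤o K₁ K₂ j≥L))
           (*-inv-cancel h 0<B) (*-inv-cancel h 0<C)

_*ℝ_ : ℝ → ℝ → ℝ
x *ℝ y = mkℝ (λ i → seq x i * seq y i) (*-cauchy {seq x} {seq y} (cauchy x) (cauchy y))

inv-cauchy : ∀ {x} → IsCauchy x → ∀ {η K} → 0ℚ < η →
             (∀ i → K ℕ.≤ i → η ≤ x i) → IsCauchy (λ i → inv (x i))
inv-cauchy {x} cx {η} {K} 0<η η≤x ε 0<ε
  with cx (η * η * ε) (0<*0< (0<*0< 0<η 0<η) 0<ε)
... | L , h = K ℕ.⊔ L , λ i j i≥ j≥ →
  let open ℚₚ.≤-Reasoning
      η≤xᵢ = η≤x i (ℕₚ.m⊔n≤o⇒m≤o K L i≥)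
      η≤xⱼ = η≤x j (ℕₚ.m⊔n≤o⇒m≤o K L j≥)
      0<xᵢ = ℚₚ.<-≤-trans 0<η η≤xᵢ
      0<xⱼ = ℚₚ.<-≤-trans 0<η η≤xⱼ
      0<ii = 0<*0< (inv-positive 0<xᵢ) (inv-positive 0<xⱼ)
      0<ηη = 0<*0< (0<*0< 0<η 0<η) 0<ε
  in begin
  ℚ.∣ inv (x i) - inv (x j) ∣
    ≡⟨ cong ℚ.∣_∣ (diff 0<xᵢ 0<xⱼ) ⟩
  ℚ.∣ (inv (x i) * inv (x j)) * (x j - x i) ∣
    ≡⟨ ℚₚ.∣p*q∣≡∣p∣*∣q∣ (inv (x i) * inv (x j)) (x j - x i) ⟩
  ℚ.∣ inv (x i) * inv (x j) ∣ * ℚ.∣ x j - x i ∣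
    ≡⟨ cong (_* ℚ.∣ x j - x i ∣) (ℚₚ.0≤p⇒∣p∣≡p (ℚₚ.<⇒≤ 0<ii)) ⟩
  (inv (x i) * inv (x j)) * ℚ.∣ x j - x i ∣
    ≤⟨ *-mono-≤-nonNeg (ℚₚ.<⇒≤ 0<ii) (ℚₚ.<⇒≤ 0<ηη)
         (*-mono-≤-nonNeg (ℚₚ.<⇒≤ (inv-positive 0<xᵢ))
           (ℚₚ.<⇒≤ (inv-positive 0<η))
           (inv-antimono 0<η η≤xᵢ) (inv-antimono 0<η η≤xⱼ))
         (h j i (ℕₚ.m⊔n≤o⇒n≤o K L j≥) (ℕₚ.m⊔n≤o⇒n≤o K L i≥)) ⟩
  (inv η * inv η) * (η * η * ε)
    ≡⟨ cancel ⟩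
  ε ∎
  where
  open +-*-Solver
  diff : ∀ {a b} → 0ℚ < a → 0ℚ < b → inv a - inv b ≡ (inv a * inv b) * (b - a)
  diff {a} {b} 0<a 0<b = sym (trans
    (solve 4 (λ a b a' b' → (a' :* b') :* (b :+ (:- a))
               := a' :* (b' :* b) :+ (:- (b' :* (a' :* a)))) refl
       a b (inv a) (inv b))
    (cong₂ _-_
      (trans (cong (inv a *_) (inv-inverseˡ 0<b)) (ℚₚ.*-identityʳ (inv a)))
      (trans (cong (inv b *_) (inv-inverseˡ 0<a)) (ℚₚ.*-identityʳ (inv b)))))
  cancel : (inv η * inv η) * (η * η * ε) ≡ ε
  cancel = trans
    (solve 3 (λ e e' z → (e' :* e') :* (e :* e :* z)
               := (e' :* e) :* ((e' :* e) :* z)) refl η (inv η) ε)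
    (trans (cong (λ p → p * (p * ε)) (inv-inverseˡ 0<η))
      (trans (ℚₚ.*-identityˡ _) (ℚₚ.*-identityˡ ε)))

-- The value does not depend on the proof of positivity: the sequence inverts
-- termwise, and inv 0ℚ = 0ℚ only occurs at finitely many indices.
_/ℝ_[_] : (x y : ℝ) → 0ℝ <ℝ y → ℝ
x /ℝ y [ mk< η 0<η K h ] = x *ℝ mkℝ (λ i → inv (seq y i))
  (inv-cauchy {seq y} (cauchy y) 0<η λ i i≥ →
    subst (_≤ seq y i) (ℚₚ.+-identityˡ η) (h i i≥))

∑ : ℕ → (ℕ → ℚ) → ℚ
∑ zero    f = 0ℚ
∑ (suc n) f = ∑ n f + f n

-- ln m is the limit of the right Riemann sums of ∫₁ᵐ dt/t with mesh 1/N,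
-- N = k + 1; the terms are (1/N) · 1/(1 + (i+1)/N) = 1/(N + i + 1)
-- for i < (m - 1)N.
lnSeq : ℕ → ℕ → ℚ
lnSeq m k = ∑ (pred m ℕ.* suc k) λ i → + 1 ℚ./ suc (suc k ℕ.+ i)

toℚᵘ-/ : ∀ n d → toℚᵘ (n ℚ./ suc d) ℚᵘ.≃ ℚᵘ.mkℚᵘ n d
toℚᵘ-/ n d = ℚₚ.toℚᵘ-fromℚᵘ (ℚᵘ.mkℚᵘ n d)

1/-antimono : ∀ {m n} → m ℕ.≤ n → + 1 ℚ./ suc n ≤ + 1 ℚ./ suc m
1/-antimono {m} {n} m≤n = ℚₚ.toℚᵘ-cancel-≤
  (ℚᵘₚ.≤-trans (ℚᵘₚ.≤-reflexive (toℚᵘ-/ (+ 1) n))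
  (ℚᵘₚ.≤-trans (ℚᵘ.*≤* (ℤₚ.*-monoˡ-≤-nonNeg (+ 1) (ℤ.+≤+ (s≤s m≤n))))
    (ℚᵘₚ.≤-reflexive (ℚᵘₚ.≃-sym (toℚᵘ-/ (+ 1) m)))))

suc/1 : ∀ n → + suc n ℚ./ 1 ≡ (+ n ℚ./ 1) + 1ℚ
suc/1 n = ℚₚ.toℚᵘ-injective
  (ℚᵘₚ.≃-trans (toℚᵘ-/ (+ suc n) 0)
  (ℚᵘₚ.≃-sym (ℚᵘₚ.≃-trans (ℚₚ.toℚᵘ-homo-+ (+ n ℚ./ 1) 1ℚ)
    (ℚᵘₚ.≃-trans (ℚᵘₚ.+-cong (toℚᵘ-/ (+ n) 0) (toℚᵘ-/ (+ 1) 0))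
      (ℚᵘ.*≡* (eq (+ n)))))))
  where
  eq : ∀ x → (x ℤ.* + 1 ℤ.+ + 1 ℤ.* + 1) ℤ.* + 1 ≡ (+ 1 ℤ.+ x) ℤ.* + 1
  eq = ℤ-Ring.solve-∀

*1/* : ∀ A M {c} → suc c ≡ suc A ℕ.* suc M →
       (+ suc M ℚ./ 1) * (+ 1 ℚ./ suc c) ≡ + 1 ℚ./ suc A
*1/* A M {c} e = ℚₚ.toℚᵘ-injective
  (ℚᵘₚ.≃-trans (ℚₚ.toℚᵘ-homo-* (+ suc M ℚ./ 1) (+ 1 ℚ./ suc c))
  (ℚᵘₚ.≃-trans (ℚᵘₚ.*-cong (toℚᵘ-/ (+ suc M) 0) (toℚᵘ-/ (+ 1) c))
  (ℚᵘₚ.≃-trans (ℚᵘ.*≡* (cong +_ eq)) (ℚᵘₚ.≃-sym (toℚᵘ-/ (+ 1) A)))))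
  where
  lem : ∀ A M → (suc M ℕ.* 1) ℕ.* suc A ≡ 1 ℕ.* (1 ℕ.* (suc A ℕ.* suc M))
  lem = ℕ-Ring.solve-∀
  eq : (suc M ℕ.* 1) ℕ.* suc A ≡ 1 ℕ.* (1 ℕ.* suc c)
  eq = trans (lem A M) (cong (λ z → 1 ℕ.* (1 ℕ.* z)) (sym e))

archimedes : ∀ ε → 0ℚ < ε → ∃[ K ] (+ 1 ℚ./ suc K ≤ ε)
archimedes ε@(mkℚ (+ zero) d _) (ℚ.*<* (ℤ.+<+ ()))
archimedes (mkℚ ℤ.-[1+ _ ] d _) (ℚ.*<* ())
archimedes ε@(mkℚ +[1+ n ] d _) _ = d , ℚₚ.toℚᵘ-cancel-≤
  (ℚᵘₚ.≤-trans (ℚᵘₚ.≤-reflexive (toℚᵘ-/ (+ 1) d))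
    (ℚᵘ.*≤* (ℤₚ.*-monoʳ-≤-nonNeg (+ suc d) {+ 1} {+[1+ n ]} (ℤ.+≤+ (s≤s z≤n)))))

∑-mono : ∀ n {f g} → (∀ i → i ℕ.< n → f i ≤ g i) → ∑ n f ≤ ∑ n g
∑-mono zero    h = ℚₚ.≤-refl
∑-mono (suc n) h = ℚₚ.+-mono-≤
  (∑-mono n λ i i<n → h i (ℕₚ.m<n⇒m<1+n i<n)) (h n ℕₚ.≤-refl)

∑-cong : ∀ n {f g} → (∀ i → f i ≡ g i) → ∑ n f ≡ ∑ n g
∑-cong zero    h = refl
∑-cong (suc n) h = cong₂ _+_ (∑-cong n h) (h n)

∑-++ : ∀ m n f → ∑ (m ℕ.+ n) f ≡ ∑ m f + ∑ n (λ i → f (m ℕ.+ i))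
∑-++ m zero    f = trans (cong (λ k → ∑ k f) (ℕₚ.+-identityʳ m))
                         (sym (ℚₚ.+-identityʳ _))
∑-++ m (suc n) f = trans (cong (λ k → ∑ k f) (ℕₚ.+-suc m n))
  (trans (cong (_+ f (m ℕ.+ n)) (∑-++ m n f)) (ℚₚ.+-assoc (∑ m f) _ _))

∑-blocks : ∀ a M f → ∑ (a ℕ.* M) f ≡ ∑ a λ i → ∑ M λ j → f (i ℕ.* M ℕ.+ j)
∑-blocks zero    M f = refl
∑-blocks (suc a) M f = trans (cong (λ k → ∑ k f) (ℕₚ.+-comm M (a ℕ.* M)))
  (trans (∑-++ (a ℕ.* M) M f) (cong (_+ ∑ M λ j → f (a ℕ.* M ℕ.+ j)) (∑-blocks a M f)))

∑-const : ∀ n c → ∑ n (λ _ → c) ≡ (+ n ℚ./ 1) * c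
∑-const zero    c = sym (ℚₚ.*-zeroˡ c)
∑-const (suc n) c = trans (cong (_+ c) (∑-const n c)) (sym
  (trans (cong (_* c) (suc/1 n)) (trans (ℚₚ.*-distribʳ-+ c (+ n ℚ./ 1) 1ℚ)
    (cong (λ z → (+ n ℚ./ 1) * c + z) (ℚₚ.*-identityˡ c)))))

∑-telescope : ∀ k n →
  ∑ n (λ a → + 1 ℚ./ suc (k ℕ.+ a)) + (+ 1 ℚ./ suc (k ℕ.+ n)) ≡
  (+ 1 ℚ./ suc k) + ∑ n (λ a → + 1 ℚ./ suc (suc k ℕ.+ a))
∑-telescope k zero    = trans (ℚₚ.+-identityˡ _)
  (trans (cong (λ z → + 1 ℚ./ suc z) (ℕₚ.+-identityʳ k)) (sym (ℚₚ.+-identityʳ _)))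
∑-telescope k (suc n) = trans
  (cong₂ _+_ (∑-telescope k n) (cong (λ z → + 1 ℚ./ suc z) (ℕₚ.+-suc k n)))
  (ℚₚ.+-assoc (+ 1 ℚ./ suc k) _ _)

module Refinement (m k l : ℕ) where
  kl : ℕ
  kl = l ℕ.+ k ℕ.* suc l

  d = pred m

  term : ℕ → ℕ → ℚ
  term a b = + 1 ℚ./ suc (suc kl ℕ.+ (a ℕ.* suc l ℕ.+ b))

  blocks : lnSeq m kl ≡ ∑ (d ℕ.* suc k) λ a → ∑ (suc l) (term a)
  blocks = trans
    (cong (λ z → ∑ z λ i → + 1 ℚ./ suc (suc kl ℕ.+ i))
      (sym (ℕₚ.*-assoc d (suc k) (suc l))))
    (∑-blocks (d ℕ.* suc k) (suc l) _)

  lower : ∀ a → + 1 ℚ./ suc (suc k ℕ.+ a) ≤ ∑ (suc l) (term a)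
  lower a = ℚₚ.≤-trans
    (ℚₚ.≤-reflexive (sym (trans (∑-const (suc l) _)
      (*1/* (suc k ℕ.+ a) l {l ℕ.+ (suc k ℕ.+ a) ℕ.* suc l} refl))))
    (∑-mono (suc l) λ b b<l → 1/-antimono (bound b b<l))
    where
    lem : ∀ k l a → suc (l ℕ.+ k ℕ.* suc l) ℕ.+ (a ℕ.* suc l ℕ.+ l) ≡
          l ℕ.+ (suc k ℕ.+ a) ℕ.* suc l
    lem = ℕ-Ring.solve-∀
    bound : ∀ b → b ℕ.< suc l →
            suc kl ℕ.+ (a ℕ.* suc l ℕ.+ b) ℕ.≤ l ℕ.+ (suc k ℕ.+ a) ℕ.* suc l
    bound b (s≤s b≤l) = ℕₚ.≤-trans
      (ℕₚ.+-monoʳ-≤ (suc kl) (ℕₚ.+-monoʳ-≤ (a ℕ.* suc l) b≤l))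
      (ℕₚ.≤-reflexive (lem k l a))

  upper : ∀ a → ∑ (suc l) (term a) ≤ + 1 ℚ./ suc (k ℕ.+ a)
  upper a = ℚₚ.≤-trans
    (∑-mono (suc l) λ b _ → 1/-antimono (bound b))
    (ℚₚ.≤-reflexive (trans (∑-const (suc l) _)
      (*1/* (k ℕ.+ a) l {l ℕ.+ (k ℕ.+ a) ℕ.* suc l} refl)))
    where
    lem : ∀ k l a b → suc (l ℕ.+ k ℕ.* suc l) ℕ.+ (a ℕ.* suc l ℕ.+ b) ≡
          (l ℕ.+ (k ℕ.+ a) ℕ.* suc l) ℕ.+ suc b
    lem = ℕ-Ring.solve-∀
    bound : ∀ b → l ℕ.+ (k ℕ.+ a) ℕ.* suc l ℕ.≤ suc kl ℕ.+ (a ℕ.* suc l ℕ.+ b)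
    bound b = ℕₚ.≤-trans (ℕₚ.m≤m+n _ (suc b))
      (ℕₚ.≤-reflexive (sym (lem k l a b)))

  lnSeq≤ : lnSeq m k ≤ lnSeq m kl
  lnSeq≤ = ℚₚ.≤-trans (∑-mono (d ℕ.* suc k) λ a _ → lower a)
    (ℚₚ.≤-reflexive (sym blocks))

  ≤lnSeq+ : lnSeq m kl ≤ lnSeq m k + (+ 1 ℚ./ suc k)
  ≤lnSeq+ = let open ℚₚ.≤-Reasoning in begin
    lnSeq m kl
      ≡⟨ blocks ⟩
    ∑ (d ℕ.* suc k) (λ a → ∑ (suc l) (term a))
      ≤⟨ ∑-mono (d ℕ.* suc k) (λ a _ → upper a) ⟩
    U
      ≡⟨ sym (ℚₚ.+-identityʳ U) ⟩
    U + 0ℚ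
      ≤⟨ ℚₚ.+-monoʳ-≤ U 0≤ ⟩
    U + (+ 1 ℚ./ suc (k ℕ.+ d ℕ.* suc k))
      ≡⟨ ∑-telescope k (d ℕ.* suc k) ⟩
    (+ 1 ℚ./ suc k) + lnSeq m k
      ≡⟨ ℚₚ.+-comm (+ 1 ℚ./ suc k) (lnSeq m k) ⟩
    lnSeq m k + (+ 1 ℚ./ suc k) ∎
    where
    U = ∑ (d ℕ.* suc k) λ a → + 1 ℚ./ suc (k ℕ.+ a)
    0≤ : 0ℚ ≤ + 1 ℚ./ suc (k ℕ.+ d ℕ.* suc k)
    0≤ = ℚₚ.nonNegative⁻¹ _
      {{ℚₚ.normalize-nonNeg 1 (suc (k ℕ.+ d ℕ.* suc k))}}

lnSeq-close : ∀ m i j → lnSeq m i ≤ lnSeq m j + (+ 1 ℚ./ suc j)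
lnSeq-close m i j = ℚₚ.≤-trans (Refinement.lnSeq≤ m i j)
  (subst (λ z → lnSeq m z ≤ lnSeq m j + (+ 1 ℚ./ suc j)) (eq j i)
    (Refinement.≤lnSeq+ m j i))
  where
  eq : ∀ j i → i ℕ.+ j ℕ.* suc i ≡ j ℕ.+ i ℕ.* suc j
  eq = ℕ-Ring.solve-∀

lnSeq-cauchy : ∀ m → IsCauchy (lnSeq m)
lnSeq-cauchy m ε 0<ε with archimedes ε 0<ε
... | K , 1/K≤ε = K , λ i j i≥ j≥ → ∣x∣≤
  (close i j j≥)
  (subst (_≤ ε) (sym (-[p-q] (lnSeq m i) (lnSeq m j))) (close j i i≥))
  where
  close : ∀ i j → K ℕ.≤ j → lnSeq m i - lnSeq m j ≤ ε
  close i j j≥ = ≤-shift (ℚₚ.≤-trans (lnSeq-close m i j)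
    (ℚₚ.+-monoʳ-≤ (lnSeq m j) (ℚₚ.≤-trans (1/-antimono j≥) 1/K≤ε)))

ln : (m : ℕ) → .{{NonZero m}} → ℝ
ln m = mkℝ (lnSeq m) (lnSeq-cauchy m)

1≤suc/1 : ∀ n → 1ℚ ≤ + suc n ℚ./ 1
1≤suc/1 n = subst (1ℚ ≤_) (sym (suc/1 n))
  (subst (_≤ (+ n ℚ./ 1) + 1ℚ) (ℚₚ.+-identityˡ 1ℚ)
    (ℚₚ.+-monoˡ-≤ 1ℚ (ℚₚ.nonNegative⁻¹ (+ n ℚ./ 1) {{ℚₚ.normalize-nonNeg n 1}})))

0≤lnSeq : ∀ m k → 0ℚ ≤ lnSeq m k
0≤lnSeq m k = subst (_≤ lnSeq m k) (trans (∑-const N 0ℚ) (ℚₚ.*-zeroʳ (+ N ℚ./ 1)))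
  (∑-mono N λ i _ → ℚₚ.nonNegative⁻¹ _
    {{ℚₚ.normalize-nonNeg 1 (suc (suc k ℕ.+ i))}})
  where N = pred m ℕ.* suc k

fromℕ>0 : ∀ n .{{_ : NonZero n}} → 0ℝ <ℝ fromℕ n
fromℕ>0 (suc n) = mk< 1ℚ (ℚₚ.positive⁻¹ 1ℚ) 0 λ _ _ →
  subst (_≤ + suc n ℚ./ 1) (sym (ℚₚ.+-identityˡ 1ℚ)) (1≤suc/1 n)

ln+1>0 : ∀ m .{{_ : NonZero m}} → 0ℝ <ℝ ln m +ℝ 1ℝ
ln+1>0 m = mk< 1ℚ (ℚₚ.positive⁻¹ 1ℚ) 0 λ i _ →
  ℚₚ.+-monoˡ-≤ 1ℚ {0ℚ} {lnSeq m i} (0≤lnSeq m i)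

{-# OPTIONS --safe #-}

-- Let S₁, …, Sₘ be subsets of size at least d of an n-set, and hit them
-- greedily. While U sets remain unhit, double counting gives a point in
-- r ≥ max(1, dU/n) of them, so the concave potential f with f(0) = 0 and
-- f′(U) = min(1, n/(dU)) drops by at least 1 in each step. For m = n this yields
-- a hitting set of size at most f(n) = (n/d)(ln d + 1), with no rounding loss;
-- replacing ∫ f′ by a right Riemann sum of mesh 1/d turns ln d into the term
-- lnSeq d (n - 1) of its defining sequence.
--
-- Hitting all open neighbourhoods (d = δ) or all closed ones (d = δ + 1) gives a
-- total dominating or a dominating set X. The hypothesis on n forces |X| < δ
-- (in the second case because (ln x + 1)/x is decreasing), so every vertex has a
-- neighbour outside X and X is restrained.
module Submission where

open import Data.Bool using (Bool; true; false; _∧_)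
open import Data.Fin using (Fin; zero; suc)
import Data.Fin.Properties as Finₚ
open import Data.Fin.Subset
  using (Subset; _∈_; _∉_; _⊆_; ∣_∣; _∩_; _∪_; _─_; ⁅_⁆; ⊤; ⊥; inside; outside)
import Data.Fin.Subset.Properties as Sₚ
open import Data.Integer using (+_)
open import Data.Nat as ℕ using (ℕ; zero; suc; NonZero; z≤n; s≤s)
open import Data.Nat.Induction using (Acc; acc; <-wellFounded)
import Data.Nat.Properties as ℕₚ
open import Algebra.Properties.Semiring.Sum ℕₚ.+-*-semiring
  using (sum; sum-cong-≗; ∑-comm; *-distribˡ-sum; *-distribʳ-sum)
open import Data.Product using (_×_; _,_; ∃-syntax; proj₁; proj₂)
open import Data.Rational using (ℚ; 0ℚ; 1ℚ; _+_; _*_; _≤_; _<_)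
import Data.Rational as ℚ
import Data.Rational.Properties as ℚₚ
open import Data.Rational.Solver using (module +-*-Solver)
open import Data.Sum using (inj₁; inj₂)
open import Data.Vec using (lookup; tabulate; []; _∷_)
open import Data.Vec.Properties
  using (lookup∘tabulate; lookup-zipWith; []=⇒lookup; lookup⇒[]=)
open import Defs
open import Function using (_∘_)
open import Level using (0ℓ)
open import Relation.Binary.PropositionalEquality
  using (_≡_; refl; sym; trans; cong; subst; subst₂; module ≡-Reasoning)
open import Relation.Nullary
  using (yes; no; contradiction; does; ¬?; _×-dec_; _→-dec_)
open import Relation.Nullary.Decidable using (decidable-stable)
open import Relation.Unary using (Pred; Decidable)

-- Finite sums and cardinalities of subsets.

sum-mono-≤ : ∀ {n} {f g : Fin n → ℕ} → (∀ i → f i ℕ.≤ g i) → sum f ℕ.≤ sum g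
sum-mono-≤ {zero}  f≤g = z≤n
sum-mono-≤ {suc n} f≤g = ℕₚ.+-mono-≤ (f≤g zero) (sum-mono-≤ (f≤g ∘ suc))

pigeonhole-sum : ∀ {n} c (f : Fin (suc n) → ℕ) →
                 suc n ℕ.* c ℕ.≤ sum f → ∃[ i ] c ℕ.≤ f i
pigeonhole-sum c f h with c ℕ.≤? f zero
... | yes c≤ = zero , c≤
pigeonhole-sum {zero}  c f h | no c≰ =
  contradiction (subst₂ ℕ._≤_ (ℕₚ.+-identityʳ c) (ℕₚ.+-identityʳ (f zero)) h) c≰
pigeonhole-sum {suc n} c f h | no c≰
  with i , c≤ ← pigeonhole-sum c (f ∘ suc) (ℕₚ.+-cancelˡ-≤ c _ _ (ℕₚ.≤-trans h
                  (ℕₚ.+-monoˡ-≤ _ (ℕₚ.<⇒≤ (ℕₚ.≰⇒> c≰)))))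
  = suc i , c≤

bit : Bool → ℕ
bit true  = 1
bit false = 0

-- Writing cardinalities as sums of 0/1 values turns double counting into an exchange of two finite
-- sums.
∣p∣≡∑bit : ∀ {n} (p : Subset n) → ∣ p ∣ ≡ sum (bit ∘ lookup p)
∣p∣≡∑bit []            = refl
∣p∣≡∑bit (inside  ∷ p) = cong suc (∣p∣≡∑bit p)
∣p∣≡∑bit (outside ∷ p) = ∣p∣≡∑bit p

∣p∩q∣+∣p─q∣≡∣p∣ : ∀ {n} (p q : Subset n) → ∣ p ∩ q ∣ ℕ.+ ∣ p ─ q ∣ ≡ ∣ p ∣
∣p∩q∣+∣p─q∣≡∣p∣ []            []            = refl
∣p∩q∣+∣p─q∣≡∣p∣ (outside ∷ p) (inside  ∷ q) = ∣p∩q∣+∣p─q∣≡∣p∣ p q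
∣p∩q∣+∣p─q∣≡∣p∣ (outside ∷ p) (outside ∷ q) = ∣p∩q∣+∣p─q∣≡∣p∣ p q
∣p∩q∣+∣p─q∣≡∣p∣ (inside  ∷ p) (inside  ∷ q) = cong suc (∣p∩q∣+∣p─q∣≡∣p∣ p q)
∣p∩q∣+∣p─q∣≡∣p∣ (inside  ∷ p) (outside ∷ q) =
  trans (ℕₚ.+-suc _ _) (cong suc (∣p∩q∣+∣p─q∣≡∣p∣ p q))

∣p∪q∣≤∣p∣+∣q∣ : ∀ {n} (p q : Subset n) → ∣ p ∪ q ∣ ℕ.≤ ∣ p ∣ ℕ.+ ∣ q ∣
∣p∪q∣≤∣p∣+∣q∣ [] [] = z≤n
∣p∪q∣≤∣p∣+∣q∣ (inside  ∷ p) (inside  ∷ q) =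
  s≤s (ℕₚ.≤-trans (∣p∪q∣≤∣p∣+∣q∣ p q) (ℕₚ.+-monoʳ-≤ ∣ p ∣ (ℕₚ.n≤1+n ∣ q ∣)))
∣p∪q∣≤∣p∣+∣q∣ (inside  ∷ p) (outside ∷ q) = s≤s (∣p∪q∣≤∣p∣+∣q∣ p q)
∣p∪q∣≤∣p∣+∣q∣ (outside ∷ p) (inside  ∷ q) =
  ℕₚ.≤-trans (s≤s (∣p∪q∣≤∣p∣+∣q∣ p q)) (ℕₚ.≤-reflexive (sym (ℕₚ.+-suc _ _)))
∣p∪q∣≤∣p∣+∣q∣ (outside ∷ p) (outside ∷ q) = ∣p∪q∣≤∣p∣+∣q∣ p q

∣p∣<∣q∣⇒∃∉p∈q : ∀ {n} {p q : Subset n} → ∣ p ∣ ℕ.< ∣ q ∣ → ∃[ x ] (x ∉ p × x ∈ q)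
∣p∣<∣q∣⇒∃∉p∈q {p = p} {q} p<q
  with Finₚ.any? (λ x → ¬? (x Sₚ.∈? p) ×-dec (x Sₚ.∈? q))
... | yes ∃x = ∃x
... | no  ∄x = contradiction (Sₚ.p⊆q⇒∣p∣≤∣q∣ q⊆p) (ℕₚ.<⇒≱ p<q)
  where
  q⊆p : q ⊆ p
  q⊆p {x} x∈q = decidable-stable (x Sₚ.∈? p) λ x∉p → ∄x (x , x∉p , x∈q)

-- Well-founded descent on the cardinality: with `P` decidable, a search through all subsets either
-- finds a smaller one satisfying `P` or certifies the current one as minimum. It makes the
-- domination numbers exist constructively.
∃-minimumCardinality : ∀ {n} {P : Pred (Subset n) 0ℓ} → Decidable P →
  ∀ {X} → P X → ∃[ k ] (IsMinimumCardinality P k × k ℕ.≤ ∣ X ∣)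
∃-minimumCardinality {P = P} P? {X} PX = go X PX (<-wellFounded ∣ X ∣)
  where
  go : ∀ X → P X → Acc ℕ._<_ ∣ X ∣ → ∃[ k ] (IsMinimumCardinality P k × k ℕ.≤ ∣ X ∣)
  go X PX (acc rec) with Sₚ.anySubset? (λ Y → P? Y ×-dec (∣ Y ∣ ℕ.<? ∣ X ∣))
  ... | yes (Y , PY , Y<X) =
    let k , min , k≤Y = go Y PY (rec Y<X) in k , min , ℕₚ.≤-trans k≤Y (ℕₚ.<⇒≤ Y<X)
  ... | no ∄Y = ∣ X ∣ , ((X , PX , refl) , λ Y PY → ℕₚ.≮⇒≥ λ Y<X → ∄Y (Y , PY , Y<X)) , ℕₚ.≤-refl

-- Natural numbers inside the rationals.

ι : ℕ → ℚ
ι n = + n ℚ./ 1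

ι-+ : ∀ m n → ι (m ℕ.+ n) ≡ ι m + ι n
ι-+ zero    n = sym (ℚₚ.+-identityˡ (ι n))
ι-+ (suc m) n = begin
  ι (suc (m ℕ.+ n))    ≡⟨ suc/1 (m ℕ.+ n) ⟩
  ι (m ℕ.+ n) + 1ℚ     ≡⟨ cong (_+ 1ℚ) (ι-+ m n) ⟩
  (ι m + ι n) + 1ℚ     ≡⟨ solve 3 (λ a b c → (a :+ b) :+ c := (a :+ c) :+ b) refl (ι m) (ι n) 1ℚ ⟩
  (ι m + 1ℚ) + ι n     ≡⟨ cong (_+ ι n) (suc/1 m) ⟨
  ι (suc m) + ι n      ∎
  where
  open ≡-Reasoning
  open +-*-Solver

ι-* : ∀ m n → ι (m ℕ.* n) ≡ ι m * ι n
ι-* zero    n = sym (ℚₚ.*-zeroˡ (ι n))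
ι-* (suc m) n = begin
  ι (n ℕ.+ m ℕ.* n)    ≡⟨ ι-+ n (m ℕ.* n) ⟩
  ι n + ι (m ℕ.* n)    ≡⟨ cong (λ z → ι n + z) (ι-* m n) ⟩
  ι n + ι m * ι n      ≡⟨ solve 2 (λ a b → b :+ a :* b := (a :+ con 1ℚ) :* b) refl (ι m) (ι n) ⟩
  (ι m + 1ℚ) * ι n     ≡⟨ cong (_* ι n) (suc/1 m) ⟨
  ι (suc m) * ι n      ∎
  where
  open ≡-Reasoning
  open +-*-Solver

0≤ι : ∀ n → 0ℚ ≤ ι n
0≤ι n = ℚₚ.nonNegative⁻¹ (ι n) {{ℚₚ.normalize-nonNeg n 1}}

0<ι : ∀ n → 0ℚ < ι (suc n)
0<ι n = ℚₚ.<-≤-trans (ℚₚ.positive⁻¹ 1ℚ) (1≤suc/1 n)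

ι-mono : ∀ {m n} → m ℕ.≤ n → ι m ≤ ι n
ι-mono {m} {n} m≤n = let open ℚₚ.≤-Reasoning in begin
  ι m                    ≡⟨ ℚₚ.+-identityʳ (ι m) ⟨
  ι m + 0ℚ               ≤⟨ ℚₚ.+-monoʳ-≤ (ι m) (0≤ι (n ℕ.∸ m)) ⟩
  ι m + ι (n ℕ.∸ m)      ≡⟨ ι-+ m (n ℕ.∸ m) ⟨
  ι (m ℕ.+ (n ℕ.∸ m))    ≡⟨ cong ι (ℕₚ.m+[n∸m]≡n m≤n) ⟩
  ι n                    ∎

*-mono-≤ʳ : ∀ {p q r} → 0ℚ ≤ p → q ≤ r → p * q ≤ p * r
*-mono-≤ʳ {p} 0≤p = ℚₚ.*-monoˡ-≤-nonNeg p {{ℚ.nonNegative 0≤p}}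

*-mono-≤ˡ : ∀ {p q r} → 0ℚ ≤ p → q ≤ r → q * p ≤ r * p
*-mono-≤ˡ {p} 0≤p = ℚₚ.*-monoʳ-≤-nonNeg p {{ℚ.nonNegative 0≤p}}

ι*1/ : ∀ n → ι (suc n) * (+ 1 ℚ./ suc n) ≡ 1ℚ
ι*1/ n = *1/* 0 n (sym (ℕₚ.+-identityʳ (suc n)))

-- Greedy hitting sets and their potential.

module Greedy {m n-1 : ℕ} (S : Fin m → Subset (suc n-1)) where

  private n = suc n-1

  containing : Fin n → Subset m
  containing u = tabulate λ v → lookup (S v) u

  -- Both sides count pairs `(v , u)` with `v ∈ W` and `u ∈ S v`: each row `v` contributes at least
  -- `d`, and column `u` contributes exactly `∣ W ∩ containing u ∣`.
  double-counting : ∀ {d} → (∀ v → d ℕ.≤ ∣ S v ∣) → ∀ W →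
                    ∣ W ∣ ℕ.* d ℕ.≤ sum λ u → ∣ W ∩ containing u ∣
  double-counting {d} d≤ W = begin
    ∣ W ∣ ℕ.* d                                              ≡⟨ cong (ℕ._* d) (∣p∣≡∑bit W) ⟩
    sum (bit ∘ lookup W) ℕ.* d                               ≡⟨ *-distribʳ-sum d (bit ∘ lookup W) ⟩
    sum (λ v → bit (lookup W v) ℕ.* d)                       ≤⟨ sum-mono-≤ row ⟩
    sum (λ v → sum λ u → bit (lookup W v ∧ lookup (S v) u))  ≡⟨ ∑-comm (λ v u → bit (lookup W v ∧ lookup (S v) u)) ⟩
    sum (λ u → sum λ v → bit (lookup W v ∧ lookup (S v) u))  ≡⟨ sum-cong-≗ column ⟨
    sum (λ u → ∣ W ∩ containing u ∣)                         ∎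
    where
    open ℕₚ.≤-Reasoning
    row : ∀ v → bit (lookup W v) ℕ.* d ℕ.≤ sum λ u → bit (lookup W v ∧ lookup (S v) u)
    row v with lookup W v
    ... | true  = subst₂ ℕ._≤_ (sym (ℕₚ.*-identityˡ d)) (∣p∣≡∑bit (S v)) (d≤ v)
    ... | false = z≤n
    column : ∀ u → ∣ W ∩ containing u ∣ ≡ sum λ v → bit (lookup W v ∧ lookup (S v) u)
    column u = trans (∣p∣≡∑bit (W ∩ containing u)) (sum-cong-≗ λ v → cong bit
      (trans (lookup-zipWith _∧_ v W (containing u))
        (cong (lookup W v ∧_) (lookup∘tabulate (λ v → lookup (S v) u) v))))

  -- Some column reaches the average `d * ∣ W ∣ / n`; multiplying by `n` keeps the statement in the
  -- naturals.
  popular-point : ∀ {d} → (∀ v → d ℕ.≤ ∣ S v ∣) → ∀ W →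
                  ∃[ u ] d ℕ.* ∣ W ∣ ℕ.≤ n ℕ.* ∣ W ∩ containing u ∣
  popular-point {d} d≤ W = pigeonhole-sum (d ℕ.* ∣ W ∣) _ (begin
    n ℕ.* (d ℕ.* ∣ W ∣)                        ≡⟨ cong (n ℕ.*_) (ℕₚ.*-comm d ∣ W ∣) ⟩
    n ℕ.* (∣ W ∣ ℕ.* d)                        ≤⟨ ℕₚ.*-monoʳ-≤ n (double-counting d≤ W) ⟩
    n ℕ.* sum (λ u → ∣ W ∩ containing u ∣)     ≡⟨ *-distribˡ-sum n (λ u → ∣ W ∩ containing u ∣) ⟩
    sum (λ u → n ℕ.* ∣ W ∩ containing u ∣)     ∎)
    where open ℕₚ.≤-Reasoning

  -- n · weight i = min(1, n/(i + 1)) is the slope f′((i + 1)/d) of the potential.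
  weight : ℕ → ℚ
  weight i = + 1 ℚ./ suc (n-1 ℕ.⊔ i)

  -- The argument counts cells of width `1/d`: `ι n * Φ k` is `d` times the right Riemann sum for
  -- the potential `f` at `k/d`.
  Φ : ℕ → ℚ
  Φ k = ∑ k weight

  -- The hypothesis puts all `d * suc r` added positions at or below `n * suc r`. Each added weight
  -- is therefore at least `1/(n * suc r)`, and together, scaled by `n`, they contribute at least
  -- `d`, which pays for one chosen point.
  Φ-step : ∀ k d r → d ℕ.* suc r ℕ.+ k ℕ.≤ n ℕ.* suc r →
           ι n * Φ k + ι d ≤ ι n * Φ (k ℕ.+ d ℕ.* suc r)
  Φ-step k d r h = begin
    ι n * Φ k + ι d                            ≡⟨ cong (λ z → ι n * Φ k + z) eq ⟩
    ι n * Φ k + ι n * (ι (d ℕ.* suc r) * w)    ≡⟨ ℚₚ.*-distribˡ-+ (ι n) (Φ k) (ι (d ℕ.* suc r) * w) ⟨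
    ι n * (Φ k + ι (d ℕ.* suc r) * w)          ≡⟨ cong (λ z → ι n * (Φ k + z)) (∑-const (d ℕ.* suc r) w) ⟨
    ι n * (Φ k + ∑ (d ℕ.* suc r) (λ _ → w))
      ≤⟨ *-mono-≤ʳ (0≤ι n) (ℚₚ.+-monoʳ-≤ (Φ k) (∑-mono (d ℕ.* suc r) λ i i< → 1/-antimono (bound i i<))) ⟩
    ι n * (Φ k + ∑ (d ℕ.* suc r) (λ i → weight (k ℕ.+ i)))
      ≡⟨ cong (ι n *_) (∑-++ k (d ℕ.* suc r) weight) ⟨
    ι n * Φ (k ℕ.+ d ℕ.* suc r)                ∎
    where
    open ℚₚ.≤-Reasoning
    -- By definition `suc c` is `n * suc r`, so `w` is `1/(n * suc r)`.
    c = r ℕ.+ n-1 ℕ.* suc r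
    w = + 1 ℚ./ suc c
    eq : ι d ≡ ι n * (ι (d ℕ.* suc r) * w)
    eq = sym (trans (cong (λ z → ι n * (z * w)) (ι-* d (suc r)))
      (trans (solve 4 (λ n d r w → n :* ((d :* r) :* w) := d :* ((n :* r) :* w)) refl (ι n) (ι d) (ι (suc r)) w)
      (trans (cong (λ z → ι d * (z * w)) (sym (ι-* n (suc r))))
      (trans (cong (ι d *_) (ι*1/ c)) (ℚₚ.*-identityʳ (ι d))))))
      where open +-*-Solver
    bound : ∀ i → i ℕ.< d ℕ.* suc r → n-1 ℕ.⊔ (k ℕ.+ i) ℕ.≤ c
    bound i i< = ℕₚ.⊔-lub
      (ℕₚ.≤-pred (ℕₚ.m≤m*n n (suc r)))
      (ℕₚ.≤-pred (ℕₚ.≤-trans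
        (ℕₚ.≤-trans (ℕₚ.≤-reflexive (sym (ℕₚ.+-suc k i))) (ℕₚ.+-monoʳ-≤ k i<))
        (ℕₚ.≤-trans (ℕₚ.≤-reflexive (ℕₚ.+-comm k _)) h)))

  Hits : Subset n → Subset m → Set
  Hits X W = ∀ {v} → v ∈ W → ∃[ u ] (u ∈ X × u ∈ S v)

  hitting-set : ∀ {d} .{{_ : NonZero d}} → (∀ v → d ℕ.≤ ∣ S v ∣) → ∀ W →
                ∃[ X ] (Hits X W × ι ∣ X ∣ * ι d ≤ ι n * Φ (d ℕ.* ∣ W ∣))
  hitting-set {d} d≤ W = go W (<-wellFounded ∣ W ∣)
    where
    go : ∀ W → Acc ℕ._<_ ∣ W ∣ →
         ∃[ X ] (Hits X W × ι ∣ X ∣ * ι d ≤ ι n * Φ (d ℕ.* ∣ W ∣))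
    go W (acc rec) with popular-point d≤ W
    ... | u , pop with ∣ W ∩ containing u ∣ | ∣p∩q∣+∣p─q∣≡∣p∣ W (containing u)
    -- Here `pop` reads `d * ∣ W ∣ ≤ n * 0`; as `d` is nonzero, `W` is empty and nothing is left to
    -- hit.
    ... | zero | _ = ⊥ , (λ v∈W → contradiction ∣W∣≡0 (ℕₚ.m<n⇒n≢0 (Sₚ.x∈p⇒∣p-x∣<∣p∣ v∈W)))
      , ℚₚ.≤-reflexive (begin
      ι ∣ ⊥ {n} ∣ * ι d        ≡⟨ cong (λ z → ι z * ι d) (Sₚ.∣⊥∣≡0 n) ⟩
      0ℚ * ι d                 ≡⟨ ℚₚ.*-zeroˡ (ι d) ⟩
      0ℚ                       ≡⟨ ℚₚ.*-zeroʳ (ι n) ⟨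
      ι n * Φ 0                ≡⟨ cong (λ z → ι n * Φ z) d*∣W∣≡0 ⟨
      ι n * Φ (d ℕ.* ∣ W ∣)    ∎)
      where
      open ≡-Reasoning
      d*∣W∣≡0 : d ℕ.* ∣ W ∣ ≡ 0
      d*∣W∣≡0 = ℕₚ.n≤0⇒n≡0 (subst (d ℕ.* ∣ W ∣ ℕ.≤_) (ℕₚ.*-zeroʳ n) pop)
      ∣W∣≡0 : ∣ W ∣ ≡ 0
      ∣W∣≡0 = ℕₚ.m*n≡0⇒m≡0 ∣ W ∣ d (trans (ℕₚ.*-comm ∣ W ∣ d) d*∣W∣≡0)
    ... | suc r | split = ⁅ u ⁆ ∪ X , hits , size
      where
      W′ = W ─ containing u
      IH = go W′ (rec (subst (∣ W′ ∣ ℕ.<_) split (s≤s (ℕₚ.m≤n+m ∣ W′ ∣ r))))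
      X = proj₁ IH
      hits : Hits (⁅ u ⁆ ∪ X) W
      hits {v} v∈W with u Sₚ.∈? S v
      ... | yes u∈Sv = u , Sₚ.x∈p∪q⁺ (inj₁ (Sₚ.x∈⁅x⁆ u)) , u∈Sv
      -- A set missed by `u` stays in `W′`, so the recursive `X` hits it.
      ... | no  u∉Sv =
        let v∉ = λ v∈ → u∉Sv (lookup⇒[]= u (S v) (trans
                   (sym (lookup∘tabulate (λ v → lookup (S v) u) v)) ([]=⇒lookup v∈)))
            u′ , u′∈X , u′∈Sv = proj₁ (proj₂ IH) (Sₚ.x∈p∧x∉q⇒x∈p─q v∈W v∉)
        in u′ , Sₚ.x∈p∪q⁺ (inj₂ u′∈X) , u′∈Sv
      dsplit : d ℕ.* ∣ W ∣ ≡ d ℕ.* suc r ℕ.+ d ℕ.* ∣ W′ ∣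
      dsplit = trans (cong (d ℕ.*_) (sym split)) (ℕₚ.*-distribˡ-+ d (suc r) ∣ W′ ∣)
      size : ι ∣ ⁅ u ⁆ ∪ X ∣ * ι d ≤ ι n * Φ (d ℕ.* ∣ W ∣)
      size = begin
        ι ∣ ⁅ u ⁆ ∪ X ∣ * ι d
          ≤⟨ *-mono-≤ˡ (0≤ι d) (ι-mono (ℕₚ.≤-trans (∣p∪q∣≤∣p∣+∣q∣ ⁅ u ⁆ X)
               (ℕₚ.≤-reflexive (cong (ℕ._+ ∣ X ∣) (Sₚ.∣⁅x⁆∣≡1 u))))) ⟩
        ι (suc ∣ X ∣) * ι d
          ≡⟨ trans (cong (_* ι d) (suc/1 ∣ X ∣)) (solve 2 (λ x d → (x :+ con 1ℚ) :* d := x :* d :+ d) refl (ι ∣ X ∣) (ι d)) ⟩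
        ι ∣ X ∣ * ι d + ι d
          ≤⟨ ℚₚ.+-monoˡ-≤ (ι d) (proj₂ (proj₂ IH)) ⟩
        ι n * Φ (d ℕ.* ∣ W′ ∣) + ι d
          ≤⟨ Φ-step (d ℕ.* ∣ W′ ∣) d r (subst (ℕ._≤ n ℕ.* suc r) dsplit pop) ⟩
        ι n * Φ (d ℕ.* ∣ W′ ∣ ℕ.+ d ℕ.* suc r)
          ≡⟨ cong (λ z → ι n * Φ z) (trans (ℕₚ.+-comm (d ℕ.* ∣ W′ ∣) _) (sym dsplit)) ⟩
        ι n * Φ (d ℕ.* ∣ W ∣) ∎
        where
        open ℚₚ.≤-Reasoning
        open +-*-Solver

open Greedy using (hitting-set)

-- The first `n` weights are at most `1/n` each and sum to at most 1. The weight at `n + i` is at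
-- most `1/(n + i + 1)`, the `i`-th term of `lnSeq (suc d) n-1`.
Φ-total : ∀ n-1 (S : Fin (suc n-1) → Subset (suc n-1)) d →
          Greedy.Φ S (suc d ℕ.* suc n-1) ≤ lnSeq (suc d) n-1 + 1ℚ
Φ-total n-1 S d = begin
  Φ (n ℕ.+ d ℕ.* n)                                      ≡⟨ ∑-++ n (d ℕ.* n) weight ⟩
  Φ n + ∑ (d ℕ.* n) (λ i → weight (n ℕ.+ i))
    ≤⟨ ℚₚ.+-mono-≤ (∑-mono n λ i _ → 1/-antimono (ℕₚ.m≤m⊔n n-1 i))
                   (∑-mono (d ℕ.* n) λ i _ → 1/-antimono (ℕₚ.m≤n⊔m n-1 (n ℕ.+ i))) ⟩
  ∑ n (λ _ → + 1 ℚ./ n) + lnSeq (suc d) n-1              ≡⟨ cong (_+ lnSeq (suc d) n-1) (trans (∑-const n _) (ι*1/ n-1)) ⟩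
  1ℚ + lnSeq (suc d) n-1                                 ≡⟨ ℚₚ.+-comm 1ℚ (lnSeq (suc d) n-1) ⟩
  lnSeq (suc d) n-1 + 1ℚ                                 ∎
  where
  open ℚₚ.≤-Reasoning
  open Greedy S using (Φ; weight)
  n = suc n-1

small-hitting-set : ∀ {n-1} (S : Fin (suc n-1) → Subset (suc n-1)) d → (∀ v → suc d ℕ.≤ ∣ S v ∣) →
  ∃[ X ] ((∀ v → ∃[ u ] (u ∈ X × u ∈ S v)) ×
          ι ∣ X ∣ * ι (suc d) ≤ ι (suc n-1) * (lnSeq (suc d) n-1 + 1ℚ))
small-hitting-set {n-1} S d d≤ =
  let X , hits , size = hitting-set S d≤ ⊤ in X , (λ v → hits Sₚ.∈⊤) , (begin
    ι ∣ X ∣ * ι (suc d)                                ≤⟨ size ⟩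
    ι n * Greedy.Φ S (suc d ℕ.* ∣ ⊤ {n} ∣)             ≡⟨ cong (λ z → ι n * Greedy.Φ S (suc d ℕ.* z)) (Sₚ.∣⊤∣≡n n) ⟩
    ι n * Greedy.Φ S (suc d ℕ.* n)                     ≤⟨ *-mono-≤ʳ (0≤ι n) (Φ-total n-1 S d) ⟩
    ι n * (lnSeq (suc d) n-1 + 1ℚ)                     ∎)
  where
  open ℚₚ.≤-Reasoning
  n = suc n-1

-- Logarithmic estimates forcing the hitting sets below δ.

0<lnSeq+1 : ∀ m k → 0ℚ < lnSeq m k + 1ℚ
0<lnSeq+1 m k = ℚₚ.+-mono-≤-< (0≤lnSeq m k) (ℚₚ.positive⁻¹ 1ℚ)

-- The discrete form of `ln (δ + 1) - ln δ ≤ 1/δ`: passing from `δ` to `δ + 1` adds `N` terms, each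
-- at most `1/(δ N)`.
lnSeq-suc : ∀ d i → ι (suc d) * lnSeq (suc (suc d)) i ≤ ι (suc d) * lnSeq (suc d) i + 1ℚ
lnSeq-suc d i = begin
  ι δ * lnSeq (suc δ) i                    ≡⟨ cong (λ z → ι δ * ∑ z f) (ℕₚ.+-comm N (d ℕ.* N)) ⟩
  ι δ * ∑ (d ℕ.* N ℕ.+ N) f                ≡⟨ cong (ι δ *_) (∑-++ (d ℕ.* N) N f) ⟩
  ι δ * (lnSeq δ i + ∑ N (λ j → f (d ℕ.* N ℕ.+ j)))
    ≤⟨ *-mono-≤ʳ (0≤ι δ) (ℚₚ.+-monoʳ-≤ (lnSeq δ i) (∑-mono N λ j _ → 1/-antimono (bound j))) ⟩
  ι δ * (lnSeq δ i + ∑ N (λ _ → + 1 ℚ./ suc c))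
    ≡⟨ cong (λ z → ι δ * (lnSeq δ i + z)) (trans (∑-const N _) (*1/* d i {c} refl)) ⟩
  ι δ * (lnSeq δ i + + 1 ℚ./ δ)            ≡⟨ ℚₚ.*-distribˡ-+ (ι δ) (lnSeq δ i) _ ⟩
  ι δ * lnSeq δ i + ι δ * (+ 1 ℚ./ δ)      ≡⟨ cong (λ z → ι δ * lnSeq δ i + z) (ι*1/ d) ⟩
  ι δ * lnSeq δ i + 1ℚ                     ∎
  where
  open ℚₚ.≤-Reasoning
  δ = suc d
  N = suc i
  c = i ℕ.+ d ℕ.* N
  f : ℕ → ℚ
  f j = + 1 ℚ./ suc (N ℕ.+ j)
  bound : ∀ j → c ℕ.≤ N ℕ.+ (d ℕ.* N ℕ.+ j)
  bound j = ℕₚ.+-mono-≤ (ℕₚ.n≤1+n i) (ℕₚ.m≤m+n (d ℕ.* N) j)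

-- `(ln x + 1)/x` decreases from `δ` to `δ + 1`, in cross-multiplied form. After `lnSeq-suc` the two
-- sides differ by `L`, which is nonnegative.
[ln+1]/-antimono : ∀ d i → ι (suc d) * (lnSeq (suc (suc d)) i + 1ℚ) ≤
                           ι (suc (suc d)) * (lnSeq (suc d) i + 1ℚ)
[ln+1]/-antimono d i = begin
  a * (L′ + 1ℚ)            ≡⟨ solve 2 (λ a l → a :* (l :+ con 1ℚ) := a :* l :+ a) refl a L′ ⟩
  a * L′ + a               ≤⟨ ℚₚ.+-monoˡ-≤ a (lnSeq-suc d i) ⟩
  (a * L + 1ℚ) + a         ≡⟨ ℚₚ.+-identityˡ _ ⟨
  0ℚ + ((a * L + 1ℚ) + a)  ≤⟨ ℚₚ.+-monoˡ-≤ _ (0≤lnSeq (suc d) i) ⟩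
  L + ((a * L + 1ℚ) + a)   ≡⟨ solve 2 (λ a l → l :+ ((a :* l :+ con 1ℚ) :+ a) := (a :+ con 1ℚ) :* (l :+ con 1ℚ)) refl a L ⟩
  (a + 1ℚ) * (L + 1ℚ)      ≡⟨ cong (_* (L + 1ℚ)) (suc/1 (suc d)) ⟨
  ι (suc (suc d)) * (L + 1ℚ) ∎
  where
  open ℚₚ.≤-Reasoning
  open +-*-Solver
  a = ι (suc d)
  L = lnSeq (suc d) i
  L′ = lnSeq (suc (suc d)) i

module Bounds {n-1 d gap from} (0<gap : 0ℚ < gap)
  (n<δ²/[lnδ+1] : ∀ i → from ℕ.≤ i →
     ι (suc n-1) + gap ≤ ι (suc d) * ι (suc d) * inv (lnSeq (suc d) i + 1ℚ))
  where

  private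
    n = suc n-1
    δ = suc d

  -- index + 1 = n · (from + 1), so the mesh at index refines the one at n - 1.
  index : ℕ
  index = from ℕ.+ n-1 ℕ.* suc from

  -- The hypothesis on `n` speaks only of indices from `from` on, whereas the hitting bounds sit at
  -- `n-1`. Refining the mesh only increases the right sums, so the bounds carry over to `index`.
  lnSeq-index : ∀ m → lnSeq m n-1 ≤ lnSeq m index
  lnSeq-index m = Refinement.lnSeq≤ m n-1 from

  n*[ln+1]<δ² : ι n * (lnSeq δ index + 1ℚ) < ι δ * ι δ
  n*[ln+1]<δ² = begin-strict
    ι n * L                      ≡⟨ ℚₚ.+-identityʳ _ ⟨
    -- The positive `gap` supplies the strict inequality.
    ι n * L + 0ℚ                 <⟨ ℚₚ.+-monoʳ-< (ι n * L) (0<*0< 0<gap 0<L) ⟩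
    ι n * L + gap * L            ≡⟨ ℚₚ.*-distribʳ-+ L (ι n) gap ⟨
    (ι n + gap) * L              ≤⟨ *-mono-≤ˡ (ℚₚ.<⇒≤ 0<L) (n<δ²/[lnδ+1] index (ℕₚ.m≤m+n from _)) ⟩
    ι δ * ι δ * inv L * L        ≡⟨ *-inv-cancel (ι δ * ι δ) 0<L ⟩
    ι δ * ι δ                    ∎
    where
    open ℚₚ.≤-Reasoning
    L = lnSeq δ index + 1ℚ
    0<L = 0<lnSeq+1 δ index

  total-size<δ : ∀ {x} → ι x * ι δ ≤ ι n * (lnSeq δ n-1 + 1ℚ) → x ℕ.< δ
  total-size<δ {x} x≤ = ℕₚ.≰⇒> λ δ≤x → ℚₚ.<-irrefl refl (begin-strict
    ι δ * ι δ                        ≤⟨ *-mono-≤ˡ (0≤ι δ) (ι-mono δ≤x) ⟩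
    ι x * ι δ                        ≤⟨ x≤ ⟩
    ι n * (lnSeq δ n-1 + 1ℚ)         ≤⟨ *-mono-≤ʳ (0≤ι n) (ℚₚ.+-monoˡ-≤ 1ℚ (lnSeq-index δ)) ⟩
    ι n * (lnSeq δ index + 1ℚ)       <⟨ n*[ln+1]<δ² ⟩
    ι δ * ι δ                        ∎)
    where open ℚₚ.≤-Reasoning

  -- The contradiction of `total-size<δ`, scaled by `suc δ`; `[ln+1]/-antimono` converts the bound
  -- at `suc δ` into one at `δ`, where the hypothesis applies.
  size<δ : ∀ {x} → ι x * ι (suc δ) ≤ ι n * (lnSeq (suc δ) n-1 + 1ℚ) → x ℕ.< δ
  size<δ {x} x≤ = ℕₚ.≰⇒> λ δ≤x → ℚₚ.<-irrefl refl (begin-strict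
    ι (suc δ) * (ι δ * ι δ)                 ≤⟨ *-mono-≤ʳ (0≤ι (suc δ)) (*-mono-≤ˡ (0≤ι δ) (ι-mono δ≤x)) ⟩
    ι (suc δ) * (ι x * ι δ)                 ≡⟨ solve 3 (λ a b c → a :* (b :* c) := c :* (b :* a)) refl (ι (suc δ)) (ι x) (ι δ) ⟩
    ι δ * (ι x * ι (suc δ))                 ≤⟨ *-mono-≤ʳ (0≤ι δ) x≤ ⟩
    ι δ * (ι n * (lnSeq (suc δ) n-1 + 1ℚ))
      ≤⟨ *-mono-≤ʳ (0≤ι δ) (*-mono-≤ʳ (0≤ι n) (ℚₚ.+-monoˡ-≤ 1ℚ (lnSeq-index (suc δ)))) ⟩
    ι δ * (ι n * (lnSeq (suc δ) index + 1ℚ))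
      ≡⟨ solve 3 (λ a b c → a :* (b :* c) := b :* (a :* c)) refl (ι δ) (ι n) (lnSeq (suc δ) index + 1ℚ) ⟩
    ι n * (ι δ * (lnSeq (suc δ) index + 1ℚ))
      ≤⟨ *-mono-≤ʳ (0≤ι n) ([ln+1]/-antimono d index) ⟩
    ι n * (ι (suc δ) * (lnSeq δ index + 1ℚ))
      ≡⟨ solve 3 (λ a b c → a :* (b :* c) := b :* (a :* c)) refl (ι n) (ι (suc δ)) (lnSeq δ index + 1ℚ) ⟩
    ι (suc δ) * (ι n * (lnSeq δ index + 1ℚ))
      <⟨ ℚₚ.*-monoʳ-<-pos (ι (suc δ)) {{ℚ.positive (0<ι δ)}} n*[ln+1]<δ² ⟩
    ι (suc δ) * (ι δ * ι δ)                 ∎)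
    where
    open ℚₚ.≤-Reasoning
    open +-*-Solver

-- From rational size bounds to real inequalities.

divide-bound : ∀ x δ n l l′ ε → 0ℚ < δ → 0ℚ < n →
  x * δ ≤ n * (l + 1ℚ) → l ≤ l′ + ε * inv (inv δ * n) → x ≤ (l′ + 1ℚ) * inv δ * n + ε
divide-bound x δ n l l′ ε 0<δ 0<n x≤ l≤ = begin
  x                                 ≡⟨ ℚₚ.*-identityʳ x ⟨
  x * 1ℚ                            ≡⟨ cong (x *_) (inv-inverseˡ 0<δ) ⟨
  x * (inv δ * δ)                   ≡⟨ solve 3 (λ x w δ → x :* (w :* δ) := (x :* δ) :* w) refl x (inv δ) δ ⟩
  (x * δ) * inv δ                   ≤⟨ *-mono-≤ˡ {inv δ} (ℚₚ.<⇒≤ (inv-positive 0<δ)) x≤ ⟩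
  (n * (l + 1ℚ)) * inv δ
    ≡⟨ solve 3 (λ n l w → (n :* l) :* w := (w :* n) :* l) refl n (l + 1ℚ) (inv δ) ⟩
  e * (l + 1ℚ)                      ≤⟨ *-mono-≤ʳ {e} (ℚₚ.<⇒≤ 0<e) (ℚₚ.+-monoˡ-≤ 1ℚ l≤) ⟩
  e * ((l′ + ε * inv e) + 1ℚ)
    ≡⟨ solve 5 (λ w n l ε v → (w :* n) :* ((l :+ ε :* v) :+ con 1ℚ)
                           := ((l :+ con 1ℚ) :* w) :* n :+ (ε :* v) :* (w :* n)) refl
         (inv δ) n l′ ε (inv e) ⟩
  (l′ + 1ℚ) * inv δ * n + ε * inv e * e
    ≡⟨ cong (λ z → (l′ + 1ℚ) * inv δ * n + z) (*-inv-cancel ε 0<e) ⟩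
  (l′ + 1ℚ) * inv δ * n + ε         ∎
  where
  open ℚₚ.≤-Reasoning
  open +-*-Solver
  -- The size bound amounts to `x ≤ e * (l + 1)`, so an error of `ε/e` in the logarithm costs
  -- exactly `ε`.
  e = inv δ * n
  0<e = 0<*0< (inv-positive 0<δ) 0<n

-- The unfolding of fromℕ k ≤ℝ ((ln d +ℝ 1ℝ) /ℝ fromℕ d [ _ ]) *ℝ fromℕ n: stated
-- for reals, it makes conversion checking compare the Cauchy proofs.
LogBound : ℕ → ℕ → ℕ → Set
LogBound d n k = ∀ ε → 0ℚ < ε →
  ∃[ K ] (∀ i → K ℕ.≤ i → ι k ≤ (lnSeq d i + 1ℚ) * inv (ι d) * ι n + ε)

-- The size bound is known at the single index `n-1`, but the real inequality concerns all late `i`.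
-- By `lnSeq-close` the change of index costs at most `1/(i + 1)`, and `K` is chosen to make this at
-- most `ε/e` with `e = n/δ`.
logBound : ∀ n-1 d {k x} → k ℕ.≤ x →
  ι x * ι (suc d) ≤ ι (suc n-1) * (lnSeq (suc d) n-1 + 1ℚ) → LogBound (suc d) (suc n-1) k
logBound n-1 d {k} {x} k≤x x≤ ε 0<ε = bound (archimedes _ 0<ε/e)
  where
  n = suc n-1
  δ = suc d
  0<ε/e = 0<*0< 0<ε (inv-positive (0<*0< (inv-positive (0<ι d)) (0<ι n-1)))
  bound : ∃[ K ] (+ 1 ℚ./ suc K ≤ ε * inv (inv (ι δ) * ι n)) →
          ∃[ K ] (∀ i → K ℕ.≤ i → ι k ≤ (lnSeq δ i + 1ℚ) * inv (ι δ) * ι n + ε)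
  bound (K , 1/K≤) = K , λ i K≤i →
    ℚₚ.≤-trans (ι-mono k≤x)
      (divide-bound (ι x) (ι δ) (ι n) (lnSeq δ n-1) (lnSeq δ i) ε (0<ι d) (0<ι n-1) x≤
        (ℚₚ.≤-trans (lnSeq-close δ n-1 i)
          (ℚₚ.+-monoʳ-≤ (lnSeq δ i) (ℚₚ.≤-trans (1/-antimono K≤i) 1/K≤))))

-- Neighbourhoods and domination in graphs.

module _ {n : ℕ} (G : Graph n) where
  open Graph G

  ∈-neighbours⁻ : ∀ {v u} → u ∈ neighbours G v → v ~ u
  ∈-neighbours⁻ {v} {u} u∈ with v ~? u | trans (sym (lookup∘tabulate (λ u → does (v ~? u)) u)) ([]=⇒lookup u∈)
  ... | yes v~u | _ = v~u
  ... | no  _   | ()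

  closedNeighbours : Fin n → Subset n
  closedNeighbours v = neighbours G v ∪ ⁅ v ⁆

  -- Irreflexivity keeps `v` out of its open neighbourhood, so the inclusion is strict and closed
  -- neighbourhoods have at least `δ + 1` elements.
  degree<∣closedNeighbours∣ : ∀ v → degree G v ℕ.< ∣ closedNeighbours v ∣
  degree<∣closedNeighbours∣ v = Sₚ.p⊂q⇒∣p∣<∣q∣
    ( Sₚ.p⊆p∪q ⁅ v ⁆
    , v , Sₚ.x∈p∪q⁺ (inj₂ (Sₚ.x∈⁅x⁆ v)) , λ v∈ → ~-irr refl (∈-neighbours⁻ v∈))

  hitting⇒dominating : ∀ {X} → (∀ v → ∃[ u ] (u ∈ X × u ∈ closedNeighbours v)) → Dominating G X
  hitting⇒dominating {X} hits v v∉X with hits v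
  ... | u , u∈X , u∈N[v] with Sₚ.x∈p∪q⁻ (neighbours G v) ⁅ v ⁆ u∈N[v]
  ...   | inj₁ u∈N = u , u∈X , ∈-neighbours⁻ u∈N
  ...   | inj₂ u∈v = contradiction (subst (_∈ X) (Sₚ.x∈⁅y⁆⇒x≡y v u∈v) u∈X) v∉X

  -- A neighbourhood larger than `X` cannot fit inside `X`; this yields the restrained condition
  -- from size alone.
  small⇒outside-neighbour : ∀ {X v} → ∣ X ∣ ℕ.< degree G v → ∃[ u ] (u ∉ X × v ~ u)
  small⇒outside-neighbour X<deg =
    let u , u∉X , u∈N = ∣p∣<∣q∣⇒∃∉p∈q X<deg in u , u∉X , ∈-neighbours⁻ u∈N

  restrainedDominating? : Decidable (RestrainedDominating G)
  restrainedDominating? X =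
    Finₚ.all? (λ v → ¬? (v Sₚ.∈? X) →-dec Finₚ.any? λ u → (u Sₚ.∈? X) ×-dec (v ~? u))
    ×-dec
    Finₚ.all? (λ v → ¬? (v Sₚ.∈? X) →-dec Finₚ.any? λ u → ¬? (u Sₚ.∈? X) ×-dec (v ~? u))

  totalRestrainedDominating? : Decidable (TotalRestrainedDominating G)
  totalRestrainedDominating? X =
    restrainedDominating? X
    ×-dec
    Finₚ.all? (λ v → (v Sₚ.∈? X) →-dec Finₚ.any? λ u → (u Sₚ.∈? X) ×-dec (v ~? u))

-- Bounds for the two domination numbers.

module _ {n-1 d gap from} (G : Graph (suc n-1)) (δ≤deg : ∀ v → suc d ℕ.≤ degree G v)
  (0<gap : 0ℚ < gap)
  (n<δ²/[lnδ+1] : ∀ i → from ℕ.≤ i →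
     ι (suc n-1) + gap ≤ ι (suc d) * ι (suc d) * inv (lnSeq (suc d) i + 1ℚ))
  where
  open Bounds {n-1} {d} 0<gap n<δ²/[lnδ+1]

  private
    n = suc n-1
    δ = suc d

  hitting⇒γᵣ-bound : ∀ X → (∀ v → ∃[ u ] (u ∈ X × u ∈ closedNeighbours G v)) →
    ι ∣ X ∣ * ι (suc δ) ≤ ι n * (lnSeq (suc δ) n-1 + 1ℚ) →
    ∃[ γᵣ ] (Isγᵣ G γᵣ × LogBound (suc δ) n γᵣ)
  hitting⇒γᵣ-bound X hits size =
    let γᵣ , isγᵣ , γᵣ≤ = ∃-minimumCardinality (restrainedDominating? G) {X}
          ( hitting⇒dominating G hits
          , λ v _ → small⇒outside-neighbour G (ℕₚ.<-≤-trans (size<δ {∣ X ∣} size) (δ≤deg v)))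
    in γᵣ , isγᵣ , logBound n-1 δ {γᵣ} {∣ X ∣} γᵣ≤ size

  hitting⇒γₜᵣ-bound : ∀ X → (∀ v → ∃[ u ] (u ∈ X × u ∈ neighbours G v)) →
    ι ∣ X ∣ * ι δ ≤ ι n * (lnSeq δ n-1 + 1ℚ) →
    ∃[ γₜᵣ ] (Isγₜᵣ G γₜᵣ × LogBound δ n γₜᵣ)
  hitting⇒γₜᵣ-bound X hits size =
    let adjacent v = let u , u∈X , u∈N = hits v in u , u∈X , ∈-neighbours⁻ G u∈N
        γₜᵣ , isγₜᵣ , γₜᵣ≤ = ∃-minimumCardinality (totalRestrainedDominating? G) {X}
          ( ( (λ v _ → adjacent v)
            , λ v _ → small⇒outside-neighbour G (ℕₚ.<-≤-trans (total-size<δ {∣ X ∣} size) (δ≤deg v)))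
          , λ v _ → adjacent v)
    in γₜᵣ , isγₜᵣ , logBound n-1 d {γₜᵣ} {∣ X ∣} γₜᵣ≤ size

  γᵣ-bound : ∃[ γᵣ ] (Isγᵣ G γᵣ × LogBound (suc δ) n γᵣ)
  γᵣ-bound =
    -- `small-hitting-set` takes the predecessor of the size threshold: `δ` here stands for `δ + 1`,
    -- and `d` in the total case for `δ`.
    let X , hits , size = small-hitting-set (closedNeighbours G) δ
          (λ v → ℕₚ.≤-<-trans (δ≤deg v) (degree<∣closedNeighbours∣ G v))
    in hitting⇒γᵣ-bound X hits size

  γₜᵣ-bound : ∃[ γₜᵣ ] (Isγₜᵣ G γₜᵣ × LogBound δ n γₜᵣ)
  γₜᵣ-bound =
    let X , hits , size = small-hitting-set (neighbours G) d δ≤deg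
    in hitting⇒γₜᵣ-bound X hits size

proposition1 : ∀ {n : ℕ} (G : Graph n) (δ : ℕ) .{{_ : NonZero δ}} →
    IsMinimumDegree G δ →
    fromℕ n <ℝ (fromℕ δ *ℝ fromℕ δ) /ℝ (ln δ +ℝ 1ℝ) [ ln+1>0 δ ] →
    (∃[ γᵣ ] (Isγᵣ G γᵣ ×
    fromℕ γᵣ ≤ℝ ((ln (suc δ) +ℝ 1ℝ) /ℝ fromℕ (suc δ) [ fromℕ>0 (suc δ) ]) *ℝ fromℕ n))
    ×
    (∃[ γₜᵣ ] (Isγₜᵣ G γₜᵣ ×
    fromℕ γₜᵣ ≤ℝ ((ln δ +ℝ 1ℝ) /ℝ fromℕ δ [ fromℕ>0 δ ]) *ℝ fromℕ n))
-- The minimum degree is attained at some vertex, so the graph is nonempty.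
proposition1 {zero}    G δ       ((() , _) , _) _
proposition1 {suc n-1} G (suc d) (_ , δ≤deg) (mk< gap 0<gap from n<δ²/[lnδ+1]) =
  γᵣ-bound {n-1} {d} {gap} {from} G δ≤deg 0<gap n<δ²/[lnδ+1] ,
  γₜᵣ-bound {n-1} {d} {gap} {from} G δ≤deg 0<gap n<δ²/[lnδ+1]
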